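{- Let $\gamma \geq 0$ be an integer and let $\mathcal{M}$ be a $\gamma$-multiprojection algebra with operations $\star_a$ and endomorphisms $\pi_a$, $a \in [\gamma]$. Then the vector space $\mathcal{M}$ endowed with the binary linear operations $\dashv_a, \vdash_a$, $a \in [\gamma]$, defined for all $x, y \in \mathcal{M}$ by $$x \dashv_a y := x \star_a \pi_a(y) \qquad \text{and} \qquad x \vdash_a y := \pi_a(x) \star_a y$$ is a $\gamma$-pluriassociative algebra.
   Context: The ground field has characteristic zero; $[\gamma] = \{1, \dots, \gamma\}$; $a \uparrow a' := \max(a, a')$. A $\gamma$-multiassociative algebra is a vector space $\mathcal{M}$ with linear operations $\star_a : \mathcal{M} \otimes \mathcal{M} \to \mathcal{M}$, $a \in [\gamma]$, satisfying for all $x, y, z \in \mathcal{M}$ $(x \star_a y) \star_b z = (x \star_b y) \star_{a'} z = x \star_{a''} (y \star_b z) = x \star_b (y \star_{a'''} z)$ for all $a, a', a'', a''' \leq b \in [\gamma]$. A $\gamma$-multiprojection algebra is a $\gamma$-multiassociative algebra $\mathcal{M}$ endowed with endomorphisms $\pi_a : \mathcal{M} \to \mathcal{M}$, $a \in [\gamma]$, of $\gamma$-multiassociative algebras (linear maps commuting with all the operations $\star_b$), satisfying $\pi_a \circ \pi_{a'} = \pi_{a \uparrow a'}$ for all $a, a' \in [\gamma]$. A $\gamma$-pluriassociative algebra is a vector space with binary linear operations $\dashv_a, \vdash_a$, $a \in [\gamma]$, satisfying for all elements $x, y, z$ and all $a, a' \in [\gamma]$: $(x \vdash_{a'} y) \dashv_a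 z = x \vdash_{a'} (y \dashv_a z)$; $(x \dashv_{a \uparrow a'} y) \dashv_a z = x \dashv_a (y \vdash_{a'} z)$; $(x \dashv_{a'} y) \vdash_a z = x \vdash_a (y \vdash_{a \uparrow a'} z)$; $(x \dashv_a y) \dashv_{a \uparrow a'} z = x \dashv_a (y \dashv_{a'} z)$; $(x \vdash_{a'} y) \vdash_a z = x \vdash_{a \uparrow a'} (y \vdash_a z)$. -}

module Defs where

open import Level using (Level; _⊔_; suc)
open import Algebra.Apartness.Bundles using (HeytingField; HeytingCommutativeRing)
open import Algebra.Bundles using (CommutativeRing)
open import Algebra.Core using (Op₁; Op₂)
open import Algebra.Module.Bundles using (Module)
import Algebra.Construct.NaturalChoice.Max as NaturalMax
import Algebra.Definitions.RawMonoid as RawMonoidDefinitions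
import Algebra.Module.Morphism.Structures as ModuleMorphismStructures
open import Data.Fin.Base using (Fin; _≤_)
open import Data.Fin.Properties using (≤-totalOrder)
open import Data.Nat.Base using (ℕ)
open import Data.Product.Base using (_×_)
open import Relation.Binary.PropositionalEquality.Core using (_≡_)

private
  variable
    c ℓ₁ ℓ₂ : Level

-- Fin γ stands for [γ] = {1, …, γ}; only the order of the indices is used, so
-- the shift by one is harmless.
infixl 6 _↑_

_↑_ : {γ : ℕ} → Fin γ → Fin γ → Fin γ
_↑_ {γ} = NaturalMax._⊔_ (≤-totalOrder γ)

-- Classically a Heyting field is exactly a field, with x # y being ¬ x ≈ y.
fieldRing : HeytingField c ℓ₁ ℓ₂ → CommutativeRing c ℓ₁
fieldRing K = HeytingCommutativeRing.commutativeRing (HeytingField.heytingCommutativeRing K)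

CharacteristicZero : HeytingField c ℓ₁ ℓ₂ → Set ℓ₁
CharacteristicZero K = ∀ (n : ℕ) → n · 1# ≈ 0# → n ≡ 0
  where
  open CommutativeRing (fieldRing K)
  open RawMonoidDefinitions +-rawMonoid using () renaming (_×_ to _·_)

VectorSpace : HeytingField c ℓ₁ ℓ₂ → (m ℓm : Level) → Set (c ⊔ ℓ₁ ⊔ suc (m ⊔ ℓm))
VectorSpace K m ℓm = Module (fieldRing K) m ℓm

module _ (K : HeytingField c ℓ₁ ℓ₂) {m ℓm : Level} (V : VectorSpace K m ℓm) where

  open Module V using (Carrierᴹ; _≈ᴹ_; rawModule)
  open ModuleMorphismStructures.ModuleMorphisms rawModule rawModule
    using (IsModuleHomomorphism)

  IsLinear : Op₁ Carrierᴹ → Set (c ⊔ m ⊔ ℓm)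
  IsLinear = IsModuleHomomorphism

  -- A linear map V ⊗ V → V, given as a bilinear map. Compatibility with ≈ᴹ in
  -- both arguments is part of being a module homomorphism in each of them.
  record IsBilinear (_∙_ : Op₂ Carrierᴹ) : Set (c ⊔ m ⊔ ℓm) where
    field
      linearˡ : ∀ y → IsLinear (λ x → x ∙ y)
      linearʳ : ∀ x → IsLinear (λ y → x ∙ y)

  module _ {γ : ℕ} where

    record IsMultiassociative
      (_⋆⟨_⟩_ : Carrierᴹ → Fin γ → Carrierᴹ → Carrierᴹ) : Set (c ⊔ m ⊔ ℓm) where
      field
        ⋆-bilinear : ∀ a → IsBilinear (λ x y → x ⋆⟨ a ⟩ y)
        ⋆-assoc    : ∀ {a a′ a″ a‴ b} → a ≤ b → a′ ≤ b → a″ ≤ b → a‴ ≤ b → ∀ x y z →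
          (((x ⋆⟨ a ⟩ y) ⋆⟨ b ⟩ z)  ≈ᴹ ((x ⋆⟨ b ⟩ y) ⋆⟨ a′ ⟩ z)) ×
          (((x ⋆⟨ b ⟩ y) ⋆⟨ a′ ⟩ z) ≈ᴹ (x ⋆⟨ a″ ⟩ (y ⋆⟨ b ⟩ z))) ×
          ((x ⋆⟨ a″ ⟩ (y ⋆⟨ b ⟩ z)) ≈ᴹ (x ⋆⟨ b ⟩ (y ⋆⟨ a‴ ⟩ z)))

    record IsMultiprojection
      (_⋆⟨_⟩_ : Carrierᴹ → Fin γ → Carrierᴹ → Carrierᴹ)
      (π : Fin γ → Op₁ Carrierᴹ) : Set (c ⊔ m ⊔ ℓm) where
      field
        isMultiassociative : IsMultiassociative _⋆⟨_⟩_
        π-linear           : ∀ a → IsLinear (π a)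
        π-⋆-homo           : ∀ a b x y → π a (x ⋆⟨ b ⟩ y) ≈ᴹ (π a x ⋆⟨ b ⟩ π a y)
        π-∘                : ∀ a a′ x → π a (π a′ x) ≈ᴹ π (a ↑ a′) x

    record IsPluriassociative
      (_⊣⟨_⟩_ _⊢⟨_⟩_ : Carrierᴹ → Fin γ → Carrierᴹ → Carrierᴹ) : Set (c ⊔ m ⊔ ℓm) where
      field
        ⊣-bilinear : ∀ a → IsBilinear (λ x y → x ⊣⟨ a ⟩ y)
        ⊢-bilinear : ∀ a → IsBilinear (λ x y → x ⊢⟨ a ⟩ y)
        ⊢⊣-assoc   : ∀ a a′ x y z →
          ((x ⊢⟨ a′ ⟩ y) ⊣⟨ a ⟩ z) ≈ᴹ (x ⊢⟨ a′ ⟩ (y ⊣⟨ a ⟩ z))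
        ⊣-absorb-⊢ : ∀ a a′ x y z →
          ((x ⊣⟨ a ↑ a′ ⟩ y) ⊣⟨ a ⟩ z) ≈ᴹ (x ⊣⟨ a ⟩ (y ⊢⟨ a′ ⟩ z))
        ⊢-absorb-⊣ : ∀ a a′ x y z →
          ((x ⊣⟨ a′ ⟩ y) ⊢⟨ a ⟩ z) ≈ᴹ (x ⊢⟨ a ⟩ (y ⊢⟨ a ↑ a′ ⟩ z))
        ⊣-assoc    : ∀ a a′ x y z →
          ((x ⊣⟨ a ⟩ y) ⊣⟨ a ↑ a′ ⟩ z) ≈ᴹ (x ⊣⟨ a ⟩ (y ⊣⟨ a′ ⟩ z))
        ⊢-assoc    : ∀ a a′ x y z →
          ((x ⊢⟨ a′ ⟩ y) ⊢⟨ a ⟩ z) ≈ᴹ (x ⊢⟨ a ↑ a′ ⟩ (y ⊢⟨ a ⟩ z))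

{-# OPTIONS --safe #-}
-- Writing m for the larger of the two indices c and d, multiassociativity gives
--   (x ⋆_c y) ⋆_d z = x ⋆_c (y ⋆_d z) = (x ⋆_m y) ⋆_m z.
-- So two products of x, y, z in this order agree, however they are bracketed,
-- as soon as the maxima of their indices agree. Pushing the π's to the
-- variables puts each pluriassociativity axiom in this form.
module Submission where

open import Defs
open import Level using (Level)
open import Algebra.Apartness.Bundles using (HeytingField)
open import Algebra.Module.Bundles using (module Module)
open Module using (Carrierᴹ)
open import Data.Fin.Base using (Fin)
open import Data.Nat.Base using (ℕ)
import Algebra.Construct.NaturalChoice.Max as NaturalMax
import Algebra.Module.Morphism.Construct.Composition as Composition
import Algebra.Module.Morphism.Structures as ModuleMorphismStructures
open import Data.Fin.Properties using (≤-totalOrder; ≤-refl; ≤-total)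
open import Data.Product.Base using (proj₁; proj₂)
open import Data.Sum.Base using (inj₁; inj₂)
open import Function.Base using (_∘_)
open import Relation.Binary.PropositionalEquality
  using (_≡_; refl; sym; trans; cong)
import Relation.Binary.Reasoning.Setoid as SetoidReasoning

private
  variable
    c ℓ₁ ℓ₂ m ℓm : Level
    γ : ℕ

module _ {γ : ℕ} where
  open NaturalMax (≤-totalOrder γ) public
    using ()
    renaming
      ( ⊔-comm to ↑-comm; ⊔-assoc to ↑-assoc; ⊔-idem to ↑-idem
      ; x≤y⇒x⊔y≈y to a≤b⇒a↑b≡b; x≤y⇒y⊔x≈y to a≤b⇒b↑a≡b
      )

-- Absorption by idempotence. This law or its mirror image below matches the maxima of the indices
-- in each of the four axioms that contain `a ↑ a′`.
a↑[a↑b]≡a↑b : (a b : Fin γ) → a ↑ (a ↑ b) ≡ a ↑ b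
a↑[a↑b]≡a↑b a b = trans (sym (↑-assoc a a b)) (cong (_↑ b) (↑-idem a))

[a↑b]↑a≡a↑b : (a b : Fin γ) → (a ↑ b) ↑ a ≡ a ↑ b
[a↑b]↑a≡a↑b a b = trans (↑-comm (a ↑ b) a) (a↑[a↑b]≡a↑b a b)

module _ (K : HeytingField c ℓ₁ ℓ₂) (M : VectorSpace K m ℓm) where

  open Module M using (_≈ᴹ_; ≈ᴹ-sym; ≈ᴹ-trans; ≈ᴹ-setoid; rawModule)
  open ModuleMorphismStructures.ModuleMorphisms rawModule rawModule
    using (module IsModuleHomomorphism)
  private V = Carrierᴹ M

  IsLinear-∘ : {f g : V → V} → IsLinear K M f → IsLinear K M g → IsLinear K M (g ∘ f)
  IsLinear-∘ = Composition.isModuleHomomorphism ≈ᴹ-trans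

  module MultiassociativeProperties
    {_⋆⟨_⟩_ : V → Fin γ → V → V}
    (isMultiassociative : IsMultiassociative K M _⋆⟨_⟩_) where

    open IsMultiassociative isMultiassociative

    ⋆-congˡ : ∀ {a x y z} → y ≈ᴹ z → (x ⋆⟨ a ⟩ y) ≈ᴹ (x ⋆⟨ a ⟩ z)
    ⋆-congˡ {a} {x} =
      IsModuleHomomorphism.⟦⟧-cong (IsBilinear.linearʳ (⋆-bilinear a) x)

    ⋆-congʳ : ∀ {a x y z} → x ≈ᴹ y → (x ⋆⟨ a ⟩ z) ≈ᴹ (y ⋆⟨ a ⟩ z)
    ⋆-congʳ {a} {z = z} =
      IsModuleHomomorphism.⟦⟧-cong (IsBilinear.linearˡ (⋆-bilinear a) z)

    -- The smaller of the two indices may be raised to the larger: `⋆-assoc` lets it vary freely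
    -- below that bound, in the inner or the outer product.
    ⋆-normalˡ : ∀ a b x y z →
      ((x ⋆⟨ a ⟩ y) ⋆⟨ b ⟩ z) ≈ᴹ ((x ⋆⟨ a ↑ b ⟩ y) ⋆⟨ a ↑ b ⟩ z)
    ⋆-normalˡ a b x y z with ≤-total a b
    ... | inj₁ a≤b rewrite a≤b⇒a↑b≡b a≤b =
      -- The first `≤-refl` sets `a′` to the bound `b` itself, so the second member of the chain is
      -- the normal form.
      proj₁ (⋆-assoc a≤b ≤-refl ≤-refl ≤-refl x y z)
    ... | inj₂ b≤a rewrite a≤b⇒b↑a≡b b≤a =
      ≈ᴹ-sym (proj₁ (⋆-assoc ≤-refl b≤a ≤-refl ≤-refl x y z))

    ⋆-normalʳ : ∀ a b x y z →
      (x ⋆⟨ a ⟩ (y ⋆⟨ b ⟩ z)) ≈ᴹ ((x ⋆⟨ a ↑ b ⟩ y) ⋆⟨ a ↑ b ⟩ z)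
    ⋆-normalʳ a b x y z with ≤-total a b
    ... | inj₁ a≤b rewrite a≤b⇒a↑b≡b a≤b =
      ≈ᴹ-sym (proj₁ (proj₂ (⋆-assoc ≤-refl ≤-refl a≤b ≤-refl x y z)))
    ... | inj₂ b≤a rewrite a≤b⇒b↑a≡b b≤a =
      -- Now `a` is the bound, and the chain passes through `x ⋆⟨ a ⟩ (y ⋆⟨ a ⟩ z)`: rebracket
      -- first, then lower the inner index to `b`.
      let eqs = proj₂ (⋆-assoc ≤-refl ≤-refl ≤-refl b≤a x y z)
      in ≈ᴹ-sym (≈ᴹ-trans (proj₁ eqs) (proj₂ eqs))

    -- Both sides have the same normal form, which depends only on the maximum. Each axiom is
    -- thereby reduced to an identity between maxima of indices.
    ⋆-assoc-↑ : ∀ {a b a′ b′} → a ↑ b ≡ a′ ↑ b′ → ∀ x y z →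
      ((x ⋆⟨ a ⟩ y) ⋆⟨ b ⟩ z) ≈ᴹ (x ⋆⟨ a′ ⟩ (y ⋆⟨ b′ ⟩ z))
    ⋆-assoc-↑ {a} {b} {a′} {b′} a↑b≡a′↑b′ x y z = begin
      (x ⋆⟨ a ⟩ y) ⋆⟨ b ⟩ z
        ≈⟨ ⋆-normalˡ a b x y z ⟩
      (x ⋆⟨ a ↑ b ⟩ y) ⋆⟨ a ↑ b ⟩ z
        ≡⟨ cong (λ e → (x ⋆⟨ e ⟩ y) ⋆⟨ e ⟩ z) a↑b≡a′↑b′ ⟩
      (x ⋆⟨ a′ ↑ b′ ⟩ y) ⋆⟨ a′ ↑ b′ ⟩ z
        ≈⟨ ⋆-normalʳ a′ b′ x y z ⟨
      x ⋆⟨ a′ ⟩ (y ⋆⟨ b′ ⟩ z) ∎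
      where open SetoidReasoning ≈ᴹ-setoid

  module MultiprojectionProperties
    {_⋆⟨_⟩_ : V → Fin γ → V → V} {π : Fin γ → V → V}
    (isMultiprojection : IsMultiprojection K M _⋆⟨_⟩_ π) where

    open IsMultiprojection isMultiprojection
    open IsMultiassociative isMultiassociative using (⋆-bilinear)
    open MultiassociativeProperties isMultiassociative
    open SetoidReasoning ≈ᴹ-setoid

    -- `π a` distributes over the product and merges with the projection already on one factor; this
    -- is how projections indexed by `a ↑ a′` arise.
    π-⋆-πˡ : ∀ a a′ b x y → π a (π a′ x ⋆⟨ b ⟩ y) ≈ᴹ (π (a ↑ a′) x ⋆⟨ b ⟩ π a y)
    π-⋆-πˡ a a′ b x y = ≈ᴹ-trans (π-⋆-homo a b (π a′ x) y) (⋆-congʳ (π-∘ a a′ x))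

    π-⋆-πʳ : ∀ a a′ b x y → π a (x ⋆⟨ b ⟩ π a′ y) ≈ᴹ (π a x ⋆⟨ b ⟩ π (a ↑ a′) y)
    π-⋆-πʳ a a′ b x y = ≈ᴹ-trans (π-⋆-homo a b x (π a′ y)) (⋆-congˡ (π-∘ a a′ y))

    isPluriassociative : IsPluriassociative K M
      (λ x a y → x ⋆⟨ a ⟩ π a y) (λ x a y → π a x ⋆⟨ a ⟩ y)
    isPluriassociative = record
      { ⊣-bilinear = λ a → record
        { linearˡ = λ y → IsBilinear.linearˡ (⋆-bilinear a) (π a y)
        ; linearʳ = λ x → IsLinear-∘ (π-linear a) (IsBilinear.linearʳ (⋆-bilinear a) x)
        }
      ; ⊢-bilinear = λ a → record
        { linearˡ = λ y → IsLinear-∘ (π-linear a) (IsBilinear.linearˡ (⋆-bilinear a) y)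
        ; linearʳ = λ x → IsBilinear.linearʳ (⋆-bilinear a) (π a x)
        }
      -- No projection falls on a product here, and both sides carry the indices `a′`, `a` in this
      -- order.
      ; ⊢⊣-assoc = λ a a′ x y z → ⋆-assoc-↑ refl (π a′ x) y (π a z)
      ; ⊣-absorb-⊢ = λ a a′ x y z → begin
          (x ⋆⟨ a ↑ a′ ⟩ π (a ↑ a′) y) ⋆⟨ a ⟩ π a z
            ≈⟨ ⋆-assoc-↑ ([a↑b]↑a≡a↑b a a′) x (π (a ↑ a′) y) (π a z) ⟩
          x ⋆⟨ a ⟩ (π (a ↑ a′) y ⋆⟨ a′ ⟩ π a z)
            ≈⟨ ⋆-congˡ (π-⋆-πˡ a a′ a′ y z) ⟨
          x ⋆⟨ a ⟩ π a (π a′ y ⋆⟨ a′ ⟩ z) ∎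
      ; ⊢-absorb-⊣ = λ a a′ x y z → begin
          π a (x ⋆⟨ a′ ⟩ π a′ y) ⋆⟨ a ⟩ z
            ≈⟨ ⋆-congʳ (π-⋆-πʳ a a′ a′ x y) ⟩
          (π a x ⋆⟨ a′ ⟩ π (a ↑ a′) y) ⋆⟨ a ⟩ z
            -- The indices are `a′`, `a` on the left and `a`, `a ↑ a′` on the right; both pairs have
            -- maximum `a ↑ a′`.
            ≈⟨ ⋆-assoc-↑ (trans (↑-comm a′ a) (sym (a↑[a↑b]≡a↑b a a′)))
                 (π a x) (π (a ↑ a′) y) z ⟩
          π a x ⋆⟨ a ⟩ (π (a ↑ a′) y ⋆⟨ a ↑ a′ ⟩ z) ∎
      ; ⊣-assoc = λ a a′ x y z → begin
          (x ⋆⟨ a ⟩ π a y) ⋆⟨ a ↑ a′ ⟩ π (a ↑ a′) z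
            ≈⟨ ⋆-assoc-↑ (a↑[a↑b]≡a↑b a a′) x (π a y) (π (a ↑ a′) z) ⟩
          x ⋆⟨ a ⟩ (π a y ⋆⟨ a′ ⟩ π (a ↑ a′) z)
            ≈⟨ ⋆-congˡ (π-⋆-πʳ a a′ a′ y z) ⟨
          x ⋆⟨ a ⟩ π a (y ⋆⟨ a′ ⟩ π a′ z) ∎
      ; ⊢-assoc = λ a a′ x y z → begin
          π a (π a′ x ⋆⟨ a′ ⟩ y) ⋆⟨ a ⟩ z
            ≈⟨ ⋆-congʳ (π-⋆-πˡ a a′ a′ x y) ⟩
          (π (a ↑ a′) x ⋆⟨ a′ ⟩ π a y) ⋆⟨ a ⟩ z
            ≈⟨ ⋆-assoc-↑ (trans (↑-comm a′ a) (sym ([a↑b]↑a≡a↑b a a′)))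
                 (π (a ↑ a′) x) (π a y) z ⟩
          π (a ↑ a′) x ⋆⟨ a ↑ a′ ⟩ (π a y ⋆⟨ a ⟩ z) ∎
      }

theorem3p3p2 : ∀ {c ℓ₁ ℓ₂ m ℓm : Level}
    (K : HeytingField c ℓ₁ ℓ₂) → CharacteristicZero K →
    ∀ (γ : ℕ) (M : VectorSpace K m ℓm)
    (_⋆⟨_⟩_ : Carrierᴹ M → Fin γ → Carrierᴹ M → Carrierᴹ M)
    (π : Fin γ → Carrierᴹ M → Carrierᴹ M) →
    IsMultiprojection K M _⋆⟨_⟩_ π →
    IsPluriassociative K M
    (λ x a y → x ⋆⟨ a ⟩ π a y)
    (λ x a y → π a x ⋆⟨ a ⟩ y)
theorem3p3p2 K _ _ M _ _ = MultiprojectionProperties.isPluriassociative K M
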